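{- The flow rewriting system $\mathsf c$ is terminating on the set of cycle-free atomic flows: there is no infinite chain $A_1\to_{\mathsf c}A_2\to_{\mathsf c}\cdots$ with $A_1$ a cycle-free atomic flow.
   Context: An atomic flow is a finite directed acyclic graph whose vertices are labelled interaction (0 upper edges, 2 lower edges), cointeraction (2 upper, 0 lower), weakening (0,1), coweakening (1,0), contraction (2,1) or cocontraction (1,2); edges may also have a dangling upper or lower end; there is a polarity assignment in $\{+,-\}$ with equal polarities on the edges of a (co)contraction and distinct ones on the two edges of a (co)interaction. A path is a sequence of edges $\epsilon_1,\dots,\epsilon_h$ where the lower end of $\epsilon_i$ is the upper end of $\epsilon_{i+1}$, or the reverse of such a sequence. An $\mathsf{ai}$-path is either a path or (recursively) the concatenation $\epsilon_1,\dots,\epsilon_k,\epsilon_{k+1},\dots,\epsilon_h$ of an $\mathsf{ai}$-path ending at an interaction or cointeraction vertex $\nu$ and an $\mathsf{ai}$-path starting at $\nu$, with $\epsilon_k\neq\epsilon_{k+1}$. An $\mathsf{ai}$-cycle is an $\mathsf{ai}$-path from a vertex to itself in which no edge appears twice; a flow is cycle-free if it has no $\mathsf{ai}$-cycle. System $\mathsf c$: (1) a contraction with upper edges $\epsilon_1,\epsilon_2$ whose lower edge is an upper edge of a cointeraction with other upper edge $\epsilon_3$ is replaced by a cocontraction with upper edge $\epsilon_3$ and lower edges $\delta_1,\delta_2$ and cointeractions with upper edges $\{\epsilon_1,\delta_1\}$, $\{\epsilon_2,\delta_2\}$; (2) an interaction with lower edges $\epsilon_3,\epsilon$, where $\epsilon$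 is the upper edge of a cocontraction with lower edges $\epsilon_1,\epsilon_2$, is replaced by a contraction with lower edge $\epsilon_3$ and upper edges $\delta_1,\delta_2$ and interactions with lower edges $\{\epsilon_1,\delta_1\}$, $\{\epsilon_2,\delta_2\}$; (3) a contraction with upper edges $\epsilon_1,\epsilon_2$ whose lower edge is the upper edge of a cocontraction with lower edges $\epsilon_3,\epsilon_4$ is replaced by two cocontractions with upper edges $\epsilon_1,\epsilon_2$ and two contractions with lower edges $\epsilon_3,\epsilon_4$, with one new edge from each cocontraction to each contraction. $A\to_{\mathsf c}B$ means one rule application. -}

module Defs where

open import Data.Nat using (ℕ; zero; suc)
open import Data.Fin using (Fin)
open import Data.List using (List; []; _∷_; _++_; length; lookup; concatMap; reverse; last; head)
open import Data.List.Membership.Propositional using (_∈_; _∉_)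
open import Data.List.Relation.Unary.All using (All)
open import Data.List.Relation.Unary.Unique.Propositional using (Unique)
open import Data.List.Relation.Binary.Permutation.Propositional using (_↭_)
open import Data.Maybe using (Maybe)
open import Data.Product using (Σ; ∃; _×_; _,_)
open import Data.Sum using (_⊎_)
open import Relation.Binary.PropositionalEquality using (_≡_; _≢_)
open import Relation.Binary.Construct.Closure.Transitive using (TransClosure)
open import Relation.Nullary using (¬_)
open import Data.Unit using (⊤)

data Label : Set where
  int cint wk cowk ctr coctr : Label

upAr : Label → ℕ
upAr int   = 0
upAr cint  = 2
upAr wk    = 0
upAr cowk  = 1
upAr ctr   = 2
upAr coctr = 1

downAr : Label → ℕ
downAr int   = 2
downAr cint  = 0
downAr wk    = 1
downAr cowk  = 0
downAr ctr   = 1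
downAr coctr = 2

data Pol : Set where
  pos neg : Pol

-- Concrete representation of an atomic flow.
-- Edges are named by natural numbers.  A vertex records its label, the
-- names of its upper edges (edges whose lower end is this vertex) and of
-- its lower edges (edges whose upper end is this vertex).  An edge whose
-- upper (lower) end is not a vertex has a dangling upper (lower) end.

record Vertex : Set where
  constructor vtx
  field
    lab   : Label
    ups   : List ℕ
    downs : List ℕ
open Vertex public

record Flow : Set where
  constructor flow
  field
    edges : List ℕ
    pol   : ℕ → Pol
    verts : List Vertex
open Flow public

Vtx : Flow → Set
Vtx A = Fin (length (verts A))

vat : (A : Flow) → Vtx A → Vertex
vat A i = lookup (verts A) i

Succ : (A : Flow) → Vtx A → Vtx A → Set
Succ A u v = ∃ λ e → e ∈ downs (vat A u) × e ∈ ups (vat A v)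

Acyclic : Flow → Set
Acyclic A = ∀ u → ¬ TransClosure (Succ A) u u

incident : Vertex → List ℕ
incident v = ups v ++ downs v

PolOK : (ℕ → Pol) → Vertex → Set
PolOK p v with lab v
... | ctr   = ∀ {e f} → e ∈ incident v → f ∈ incident v → p e ≡ p f
... | coctr = ∀ {e f} → e ∈ incident v → f ∈ incident v → p e ≡ p f
... | int   = ∀ {e f} → e ∈ incident v → f ∈ incident v → e ≢ f → p e ≢ p f
... | cint  = ∀ {e f} → e ∈ incident v → f ∈ incident v → e ≢ f → p e ≢ p f
... | wk    = ⊤
... | cowk  = ⊤

VertexOK : Flow → Vertex → Set
VertexOK A v =
  length (ups v) ≡ upAr (lab v) × length (downs v) ≡ downAr (lab v) ×
  All (_∈ edges A) (incident v) × PolOK (pol A) v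

WF : Flow → Set
WF A =
  Unique (edges A) ×
  All (VertexOK A) (verts A) ×
  Unique (concatMap ups (verts A)) ×     -- each edge has at most one lower end
  Unique (concatMap downs (verts A)) ×   -- each edge has at most one upper end
  Acyclic A

data DPath (A : Flow) : Vtx A → Vtx A → List ℕ → Set where
  one  : ∀ {u v e} → e ∈ downs (vat A u) → e ∈ ups (vat A v) → DPath A u v (e ∷ [])
  cons : ∀ {u w v e es} → e ∈ downs (vat A u) → e ∈ ups (vat A w) →
         DPath A w v es → DPath A u v (e ∷ es)

Path : (A : Flow) → Vtx A → Vtx A → List ℕ → Set
Path A u v es = DPath A u v es ⊎ DPath A v u (reverse es)

IsAI : Vertex → Set
IsAI v = lab v ≡ int ⊎ lab v ≡ cint

data AIPath (A : Flow) : Vtx A → Vtx A → List ℕ → Set where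
  path : ∀ {u v es} → Path A u v es → AIPath A u v es
  join : ∀ {u ν v es fs} → AIPath A u ν es → AIPath A ν v fs →
         IsAI (vat A ν) → last es ≢ head fs → AIPath A u v (es ++ fs)

AICycle : (A : Flow) → Vtx A → List ℕ → Set
AICycle A u es = AIPath A u u es × Unique es

CycleFree : Flow → Set
CycleFree A = ∀ u es → ¬ AICycle A u es

data Step₁ (A B : Flow) : Set where
  step : ∀ e₁ e₂ e₃ x d₁ d₂ (c w : Vertex) restV restE →
    lab c ≡ ctr → ups c ↭ e₁ ∷ e₂ ∷ [] → downs c ≡ x ∷ [] →
    lab w ≡ cint → ups w ↭ x ∷ e₃ ∷ [] → downs w ≡ [] →
    verts A ↭ c ∷ w ∷ restV →
    edges A ↭ x ∷ restE →
    d₁ ∉ edges A → d₂ ∉ edges A → d₁ ≢ d₂ →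
    verts B ↭ vtx coctr (e₃ ∷ []) (d₁ ∷ d₂ ∷ [])
              ∷ vtx cint (e₁ ∷ d₁ ∷ []) []
              ∷ vtx cint (e₂ ∷ d₂ ∷ []) [] ∷ restV →
    edges B ↭ d₁ ∷ d₂ ∷ restE →
    (∀ {e} → e ∈ restE → pol B e ≡ pol A e) →
    pol B d₁ ≡ pol A e₃ → pol B d₂ ≡ pol A e₃ →
    Step₁ A B

data Step₂ (A B : Flow) : Set where
  step : ∀ e₁ e₂ e₃ x d₁ d₂ (i k : Vertex) restV restE →
    lab i ≡ int → ups i ≡ [] → downs i ↭ e₃ ∷ x ∷ [] →
    lab k ≡ coctr → ups k ≡ x ∷ [] → downs k ↭ e₁ ∷ e₂ ∷ [] →
    verts A ↭ i ∷ k ∷ restV →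
    edges A ↭ x ∷ restE →
    d₁ ∉ edges A → d₂ ∉ edges A → d₁ ≢ d₂ →
    verts B ↭ vtx ctr (d₁ ∷ d₂ ∷ []) (e₃ ∷ [])
              ∷ vtx int [] (e₁ ∷ d₁ ∷ [])
              ∷ vtx int [] (e₂ ∷ d₂ ∷ []) ∷ restV →
    edges B ↭ d₁ ∷ d₂ ∷ restE →
    (∀ {e} → e ∈ restE → pol B e ≡ pol A e) →
    pol B d₁ ≡ pol A e₃ → pol B d₂ ≡ pol A e₃ →
    Step₂ A B

data Step₃ (A B : Flow) : Set where
  step : ∀ e₁ e₂ e₃ e₄ x f₁₁ f₁₂ f₂₁ f₂₂ (c k : Vertex) restV restE →
    lab c ≡ ctr → ups c ↭ e₁ ∷ e₂ ∷ [] → downs c ≡ x ∷ [] →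
    lab k ≡ coctr → ups k ≡ x ∷ [] → downs k ↭ e₃ ∷ e₄ ∷ [] →
    verts A ↭ c ∷ k ∷ restV →
    edges A ↭ x ∷ restE →
    All (_∉ edges A) (f₁₁ ∷ f₁₂ ∷ f₂₁ ∷ f₂₂ ∷ []) →
    Unique (f₁₁ ∷ f₁₂ ∷ f₂₁ ∷ f₂₂ ∷ []) →
    -- fᵢⱼ goes from the cocontraction below eᵢ to the contraction above e₍ⱼ₊₂₎
    verts B ↭ vtx coctr (e₁ ∷ []) (f₁₁ ∷ f₁₂ ∷ [])
              ∷ vtx coctr (e₂ ∷ []) (f₂₁ ∷ f₂₂ ∷ [])
              ∷ vtx ctr (f₁₁ ∷ f₂₁ ∷ []) (e₃ ∷ [])
              ∷ vtx ctr (f₁₂ ∷ f₂₂ ∷ []) (e₄ ∷ []) ∷ restV →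
    edges B ↭ f₁₁ ∷ f₁₂ ∷ f₂₁ ∷ f₂₂ ∷ restE →
    (∀ {e} → e ∈ restE → pol B e ≡ pol A e) →
    All (λ f → pol B f ≡ pol A x) (f₁₁ ∷ f₁₂ ∷ f₂₁ ∷ f₂₂ ∷ []) →
    Step₃ A B

_→c_ : Flow → Flow → Set
A →c B = Step₁ A B ⊎ Step₂ A B ⊎ Step₃ A B

-- An oriented edge of the flow continues to other oriented edges: through a
-- vertex, or bouncing at an interaction or cointeraction.  Walks along this
-- relation are ai-paths, and in a cycle-free flow none repeats an edge, so the
-- relation is well-founded and there are positive weights of oriented edges with
-- weight α > 2 · Σ weight β, the sum being over the continuations β of α.
-- The inequalities that matter are: twice the sum of the branches is at most the
-- stem when a (co)contraction is entered from its stem, the stem is at most each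
-- branch when it is entered from a branch, and 2 · weight β ≤ weight α at a bounce.
-- Give a contraction the weight of its lower edge oriented downwards and a
-- cocontraction that of its upper edge oriented upwards.  In every rewriting step
-- the old edges can keep their weights and the new edges receive weights
-- satisfying the same inequalities, while the total over all contractions and
-- cocontractions strictly decreases.

module Submission where

open import Defs
open import Data.Empty using (⊥-elim)
open import Data.Fin using (Fin; zero; suc)
open import Data.Fin.Induction using (spo-noetherian)
open import Data.List
  using (List; []; _∷_; _++_; map; concatMap; filter; length; lookup; reverse; last; head; cartesianProduct)
import Data.List.Membership.DecPropositional as DecMembership
open import Data.List.Membership.Propositional using (_∈_; _∉_; mapWith∈; lose)
open import Data.List.Membership.Propositional.Properties
  using (∈-++⁺ˡ; ∈-++⁺ʳ; ∈-concatMap⁺; ∈-concatMap⁻; ∈-map⁻; ∈-map⁺; ∈-∃++; ∈-filter⁻; ∈-filter⁺;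
         ∈-lookup; ∈-cartesianProduct⁺; mapWith∈-cong; mapWith∈≗map)
open import Data.List.Properties using (map-cong-local; concatMap-++; map-++; map-∘; unfold-reverse)
open import Data.List.Relation.Binary.Permutation.Propositional
  using (_↭_; prep; swap; ↭-refl; ↭-sym; ↭-trans; ↭-reflexive; ↭⇒↭ₛ)
open import Data.List.Relation.Binary.Permutation.Propositional.Properties
  using (All-resp-↭; ∈-resp-↭; map⁺; ++⁺; ++⁺ʳ; ++⁺ˡ; ++-comm; ++-assoc; shift; shifts)
import Data.List.Relation.Binary.Permutation.Setoid.Properties as Permutationₛ
open import Data.List.Relation.Unary.All as All using (All; []; _∷_)
open import Data.List.Relation.Unary.All.Properties as All using (++⁻ˡ; ++⁻ʳ; ¬Any⇒All¬)
open import Data.List.Relation.Unary.AllPairs using ([]; _∷_)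
open import Data.List.Relation.Unary.Any as Any using (Any; here; there)
open import Data.List.Relation.Unary.Any.Properties using (lookup-index)
open import Data.List.Relation.Unary.Unique.Propositional using (Unique)
import Data.List.Relation.Unary.Unique.Propositional.Properties as Unique
open import Data.Maybe.Properties using (just-injective)
open import Data.Nat using (ℕ; zero; suc; _+_; _*_; _≤_; _<_; z≤n; s≤s)
open import Data.Nat.Induction using (<-wellFounded)
open import Data.Nat.ListAction using (sum)
open import Data.Nat.ListAction.Properties using (sum-++; sum-↭)
open import Data.Nat.Properties
open import Data.Nat.Solver using (module +-*-Solver)
open import Data.Product using (∃; ∃₂; _×_; _,_; proj₁; proj₂)
open import Data.Sum using (_⊎_; inj₁; inj₂)
open import Data.Unit using (⊤; tt)
open import Function using (_∘_; flip)
open import Induction.WellFounded as WF using (Acc; acc; WellFounded)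
open import Relation.Binary.Construct.Closure.Transitive as Plus using (TransClosure; [_]; _∷_)
open import Relation.Binary.PropositionalEquality
  using (_≡_; _≢_; refl; sym; trans; cong; cong₂; subst; subst₂; setoid; isEquivalence)
open import Relation.Nullary using (¬_; Dec; yes; no; contradiction; ¬?)

-- Lists under permutation.

Unique-resp-↭ : ∀ {xs ys : List ℕ} → xs ↭ ys → Unique xs → Unique ys
Unique-resp-↭ = Permutationₛ.Unique-resp-↭ (setoid ℕ) ∘ ↭⇒↭ₛ

concatMap-↭ : ∀ {A B : Set} (f : A → List B) {xs ys} → xs ↭ ys → concatMap f xs ↭ concatMap f ys
concatMap-↭ f _↭_.refl = ↭-refl
concatMap-↭ f (prep x p) = ++⁺ˡ (f x) (concatMap-↭ f p)
concatMap-↭ f (swap x y p) =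
  ↭-trans (shifts (f x) (f y)) (++⁺ˡ (f y) (++⁺ˡ (f x) (concatMap-↭ f p)))
concatMap-↭ f (_↭_.trans p q) = ↭-trans (concatMap-↭ f p) (concatMap-↭ f q)

-- Local inequalities on edge weights, and the cost.

-- Below, f and g are the weights of the edges traversed downwards and upwards.
-- Merge f g is os: a contraction with upper edges is and lower edges os or, with
-- f and g exchanged, a cocontraction with lower edges is and upper edges os.
record Merge (f g : ℕ → ℕ) (is os : List ℕ) : Set where
  constructor merge
  field
    join≤ : ∀ {e} → e ∈ is → sum (map f os) ≤ f e
    fork≤ : ∀ {e} → e ∈ os → 2 * sum (map g is) ≤ g e

-- `f` weighs edges traversed towards the vertex and `g` those traversed away from it, so an
-- interaction takes the two in the opposite order from a cointeraction.
Turn : (f g : ℕ → ℕ) → List ℕ → Set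
Turn f g es = ∀ {a b} → a ∈ es → b ∈ es → a ≢ b → 2 * g b ≤ f a

Balanced : Label → (f g : ℕ → ℕ) (us ds : List ℕ) → Set
Balanced int   f g us ds = Turn g f ds
Balanced cint  f g us ds = Turn f g us
Balanced wk    f g us ds = ⊤
Balanced cowk  f g us ds = ⊤
Balanced ctr   f g us ds = Merge f g us ds
Balanced coctr f g us ds = Merge g f ds us

BalancedAt : (f g : ℕ → ℕ) → Vertex → Set
BalancedAt f g v = Balanced (lab v) f g (ups v) (downs v)

cost : Label → (f g : ℕ → ℕ) (us ds : List ℕ) → ℕ
cost ctr   f g us ds = sum (map f ds)
cost coctr f g us ds = sum (map g us)
cost _     f g us ds = 0

costAt : (f g : ℕ → ℕ) → Vertex → ℕ
costAt f g v = cost (lab v) f g (ups v) (downs v)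

totalCost : (f g : ℕ → ℕ) → List Vertex → ℕ
totalCost f g vs = sum (map (costAt f g) vs)

EndsOK : (side : Vertex → List ℕ) → Flow → Set
EndsOK side A = Unique (concatMap side (verts A)) × All (_∈ edges A) (concatMap side (verts A))

-- The invariant carried along a chain: each step turns a weighting of the old flow into one of the
-- new flow, so cycle-freeness enters only through the first weighting.
record Weighting (f g : ℕ → ℕ) (A : Flow) : Set where
  constructor weighting
  field
    upsOK    : EndsOK ups A
    downsOK  : EndsOK downs A
    f>0      : ∀ e → 0 < f e
    g>0      : ∀ e → 0 < g e
    balanced : All (BalancedAt f g) (verts A)

-- Extending weights to fresh edges.

extend : (ℕ → ℕ) → List (ℕ × ℕ) → ℕ → ℕ
extend f [] e = f e
extend f ((d , n) ∷ kvs) e with e ≟ d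
... | yes _ = n
... | no _  = extend f kvs e

extend-∉ : ∀ f kvs {e} → e ∉ map proj₁ kvs → extend f kvs e ≡ f e
extend-∉ f [] e∉ = refl
extend-∉ f ((d , n) ∷ kvs) {e} e∉ with e ≟ d
... | yes e≡d = contradiction (here e≡d) e∉
... | no _    = extend-∉ f kvs (e∉ ∘ there)

extend-∈ : ∀ f kvs → Unique (map proj₁ kvs) → All (λ (d , n) → extend f kvs d ≡ n) kvs
extend-∈ f [] _ = []
extend-∈ f ((d , n) ∷ kvs) (d∉ ∷ uniq) = first ∷ All.zipWith later (All.map⁻ d∉ , extend-∈ f kvs uniq)
  where
  first : extend f ((d , n) ∷ kvs) d ≡ n
  first with d ≟ d
  ... | yes _  = refl
  ... | no d≢d = contradiction refl d≢d
  later : ∀ {kv} → (d ≢ proj₁ kv × extend f kvs (proj₁ kv) ≡ proj₂ kv) →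
          extend f ((d , n) ∷ kvs) (proj₁ kv) ≡ proj₂ kv
  later {k , _} (d≢k , eq) with k ≟ d
  ... | yes k≡d = contradiction (sym k≡d) d≢k
  ... | no _    = eq

extend>0 : ∀ f kvs → (∀ e → 0 < f e) → All ((0 <_) ∘ proj₂) kvs → ∀ e → 0 < extend f kvs e
extend>0 f [] f>0 [] e = f>0 e
extend>0 f ((d , n) ∷ kvs) f>0 (n>0 ∷ kvs>0) e with e ≟ d
... | yes _ = n>0
... | no _  = extend>0 f kvs f>0 kvs>0 e

-- The new function comes with just the equations that the rules use: agreement on the old edges `E`
-- and the prescribed values on the fresh ones.
extension : ∀ {E f} kvs → (∀ e → 0 < f e) → All ((0 <_) ∘ proj₂) kvs →
            All (_∉ E) (map proj₁ kvs) → Unique (map proj₁ kvs) →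
            ∃ λ f′ → (∀ e → 0 < f′ e) × (∀ {e} → e ∈ E → f′ e ≡ f e) ×
                     All (λ (d , n) → f′ d ≡ n) kvs
extension {f = f} kvs f>0 kvs>0 fresh uniq =
  extend f kvs , extend>0 f kvs f>0 kvs>0 ,
  (λ e∈E → extend-∉ f kvs λ e∈ → All.lookup fresh e∈ e∈E) , extend-∈ f kvs uniq

-- Dependence on incident edges only, and facts on concatenation.

sum-map-cong : ∀ {f g : ℕ → ℕ} {es} → All (λ e → f e ≡ g e) es → sum (map f es) ≡ sum (map g es)
sum-map-cong = cong sum ∘ map-cong-local

Merge-cong : ∀ {f f′ g g′ is os} →
             All (λ e → f′ e ≡ f e) is → All (λ e → f′ e ≡ f e) os →
             All (λ e → g′ e ≡ g e) is → All (λ e → g′ e ≡ g e) os →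
             Merge f g is os → Merge f′ g′ is os
Merge-cong fi fo gi go (merge j k) = merge
  (λ e∈ → subst₂ _≤_ (sym (sum-map-cong fo)) (sym (All.lookup fi e∈)) (j e∈))
  (λ e∈ → subst₂ _≤_ (cong (2 *_) (sym (sum-map-cong gi))) (sym (All.lookup go e∈)) (k e∈))

Turn-cong : ∀ {f f′ g g′ es} → All (λ e → f′ e ≡ f e) es → All (λ e → g′ e ≡ g e) es →
            Turn f g es → Turn f′ g′ es
Turn-cong fe ge t a∈ b∈ a≢b =
  subst₂ _≤_ (cong (2 *_) (sym (All.lookup ge b∈))) (sym (All.lookup fe a∈)) (t a∈ b∈ a≢b)

module _ {f f′ g g′ : ℕ → ℕ} {us ds : List ℕ}
         (fu : All (λ e → f′ e ≡ f e) us) (fd : All (λ e → f′ e ≡ f e) ds)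
         (gu : All (λ e → g′ e ≡ g e) us) (gd : All (λ e → g′ e ≡ g e) ds) where

  Balanced-cong : ∀ l → Balanced l f g us ds → Balanced l f′ g′ us ds
  Balanced-cong int   = Turn-cong gd fd
  Balanced-cong cint  = Turn-cong fu gu
  Balanced-cong wk    = λ _ → tt
  Balanced-cong cowk  = λ _ → tt
  Balanced-cong ctr   = Merge-cong fu fd gu gd
  Balanced-cong coctr = Merge-cong gd gu fd fu

  cost-cong : ∀ l → cost l f′ g′ us ds ≡ cost l f g us ds
  cost-cong int   = refl
  cost-cong cint  = refl
  cost-cong wk    = refl
  cost-cong cowk  = refl
  cost-cong ctr   = sum-map-cong fd
  cost-cong coctr = sum-map-cong gu

All-concatMap⁻ : ∀ {A B : Set} {P : B → Set} (f : A → List B) xs →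
                 All P (concatMap f xs) → All (All P ∘ f) xs
All-concatMap⁻ f []       _  = []
All-concatMap⁻ f (x ∷ xs) ps = ++⁻ˡ (f x) ps ∷ All-concatMap⁻ f xs (++⁻ʳ (f x) ps)

totalCost-++ : ∀ f g vs ws → totalCost f g (vs ++ ws) ≡ totalCost f g vs + totalCost f g ws
totalCost-++ f g vs ws = trans (cong sum (map-++ (costAt f g) vs ws)) (sum-++ (map (costAt f g) vs) _)

Unique-++⁻ˡ : ∀ (xs : List ℕ) {ys} → Unique (xs ++ ys) → Unique xs
Unique-++⁻ˡ []       _         = []
Unique-++⁻ˡ (x ∷ xs) (x∉ ∷ u) = ++⁻ˡ xs x∉ ∷ Unique-++⁻ˡ xs u

Unique-++⁻ʳ : ∀ (xs : List ℕ) {ys} → Unique (xs ++ ys) → Unique ys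
Unique-++⁻ʳ []       u       = u
Unique-++⁻ʳ (x ∷ xs) (_ ∷ u) = Unique-++⁻ʳ xs u

Unique-++-disjoint : ∀ (xs : List ℕ) {ys e} → Unique (xs ++ ys) → e ∈ xs → e ∉ ys
Unique-++-disjoint (x ∷ xs) (x∉ ∷ _) (here refl) e∈ys = All.lookup (++⁻ʳ xs x∉) e∈ys refl
Unique-++-disjoint (x ∷ xs) (_ ∷ u)  (there e∈)  e∈ys = Unique-++-disjoint xs u e∈ e∈ys

-- Replacing a redex inside a flow.

Progress : (f g : ℕ → ℕ) (A B : Flow) → Set
Progress f g A B = ∃₂ λ f′ g′ → Weighting f′ g′ B × totalCost f′ g′ (verts B) < totalCost f g (verts A)

-- The common shape of the three rules: `x` is the edge joining the two vertices `olds`, the fresh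
-- edges `new` join the vertices `news` to each other, and `restV` is untouched.
record LocalReplacement (A B : Flow) (olds news : List Vertex) (x : ℕ) (new : List ℕ) : Set where
  constructor replacement
  field
    {restV} : List Vertex
    {restE} : List ℕ
    vertsA  : verts A ↭ olds ++ restV
    edgesA  : edges A ↭ x ∷ restE
    fresh   : All (_∉ edges A) new
    new!    : Unique new
    vertsB  : verts B ↭ news ++ restV
    edgesB  : edges B ↭ new ++ restE

  module _ (side : Vertex → List ℕ) {kept : List ℕ}
           (oldEnds : concatMap side olds ↭ x ∷ kept) where

    endsA : concatMap side (verts A) ↭ (x ∷ kept) ++ concatMap side restV
    endsA = ↭-trans (concatMap-↭ side vertsA)
           (↭-trans (↭-reflexive (concatMap-++ side olds restV)) (++⁺ʳ _ oldEnds))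

    oldEnds∈ : EndsOK side A → All (_∈ edges A) (x ∷ kept)
    oldEnds∈ (_ , ∈A) = ++⁻ˡ _ (All-resp-↭ endsA ∈A)

    oldEnds! : EndsOK side A → Unique (x ∷ kept)
    oldEnds! (u , _) = Unique-++⁻ˡ _ (Unique-resp-↭ endsA u)

    restEnds∈ : EndsOK side A → All (All (_∈ edges A) ∘ side) restV
    restEnds∈ (_ , ∈A) = All-concatMap⁻ side restV (++⁻ʳ (x ∷ kept) (All-resp-↭ endsA ∈A))

    -- Fresh edges cannot clash with kept ends, which are edges of `A`. Kept ends survive in `B`
    -- because uniqueness separates them from `x`, the only edge removed.
    EndsOK-replace : concatMap side news ↭ new ++ kept → EndsOK side A → EndsOK side B
    EndsOK-replace newEnds (u , ∈A) with All-resp-↭ endsA ∈A | Unique-resp-↭ endsA u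
    ... | _ ∷ keep∈A | x∉ ∷ keep! =
      Unique-resp-↭ (↭-sym endsB) (Unique.++⁺ new! keep! λ (e∈new , e∈keep) →
        All.lookup fresh e∈new (All.lookup keep∈A e∈keep)) ,
      All-resp-↭ (↭-sym endsB) (All.++⁺ (All.tabulate {xs = new} (inB ∘ ∈-++⁺ˡ))
        (All.zipWith (λ (x≢e , e∈A) → kept∈B x≢e e∈A) (x∉ , keep∈A)))
      where
      inB : ∀ {e} → e ∈ new ++ restE → e ∈ edges B
      inB = ∈-resp-↭ (↭-sym edgesB)
      kept∈B : ∀ {e} → x ≢ e → e ∈ edges A → e ∈ edges B
      kept∈B x≢e e∈A with ∈-resp-↭ edgesA e∈A
      ... | here refl = contradiction refl x≢e
      ... | there e∈  = inB (∈-++⁺ʳ new e∈)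
      endsB : concatMap side (verts B) ↭ new ++ kept ++ concatMap side restV
      endsB = ↭-trans (concatMap-↭ side vertsB)
             (↭-trans (↭-reflexive (concatMap-++ side news restV))
             (↭-trans (++⁺ʳ _ newEnds) (++-assoc new kept _)))

  module _ {f g f′ g′ : ℕ → ℕ} {keptUps keptDowns : List ℕ}
    (f≡ : ∀ {e} → e ∈ edges A → f′ e ≡ f e) (g≡ : ∀ {e} → e ∈ edges A → g′ e ≡ g e)
    (f′>0 : ∀ e → 0 < f′ e) (g′>0 : ∀ e → 0 < g′ e)
    (oldUps : concatMap ups olds ↭ x ∷ keptUps)
    (oldDowns : concatMap downs olds ↭ x ∷ keptDowns)
    (newUps : concatMap ups news ↭ new ++ keptUps)
    (newDowns : concatMap downs news ↭ new ++ keptDowns) where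

    private
      totalCost-split : ∀ f g {vs} ws → vs ↭ ws ++ restV →
                        totalCost f g vs ≡ totalCost f g ws + totalCost f g restV
      totalCost-split f g ws p =
        trans (sum-↭ (map⁺ (costAt f g) p)) (totalCost-++ f g ws restV)

    -- The vertices in `restV` meet only edges of `A`, whose weights do not change. Their
    -- inequalities and costs therefore carry over, and only the redex remains to be compared.
    progress : Weighting f g A →
               (All (BalancedAt f g) olds →
                All (BalancedAt f′ g′) news × totalCost f′ g′ news < totalCost f g olds) →
               Progress f g A B
    progress (weighting upsOK downsOK _ _ balanced) redex = f′ , g′ ,
      weighting (EndsOK-replace ups oldUps newUps upsOK)
                (EndsOK-replace downs oldDowns newDowns downsOK)
                f′>0 g′>0
                (All-resp-↭ (↭-sym vertsB) (All.++⁺ (proj₁ redex′) restBalanced)) ,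
      subst₂ _<_
        (sym (trans (totalCost-split f′ g′ news vertsB) (cong (totalCost f′ g′ news +_) restCost)))
        (sym (totalCost-split f g olds vertsA))
        (+-monoˡ-< (totalCost f g restV) (proj₂ redex′))
      where
      balanced′ = All-resp-↭ vertsA balanced
      redex′ = redex (++⁻ˡ olds balanced′)
      ends∈ : All (λ v → All (_∈ edges A) (ups v) × All (_∈ edges A) (downs v)) restV
      ends∈ = All.zip (restEnds∈ ups oldUps upsOK , restEnds∈ downs oldDowns downsOK)
      restBalanced : All (BalancedAt f′ g′) restV
      restBalanced = All.zipWith
        (λ {v} ((u∈ , d∈) , bal) →
          Balanced-cong (All.map f≡ u∈) (All.map f≡ d∈) (All.map g≡ u∈) (All.map g≡ d∈) (lab v) bal)
        (ends∈ , ++⁻ʳ olds balanced′)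
      restCost : totalCost f′ g′ restV ≡ totalCost f g restV
      restCost = cong sum (map-cong-local (All.map
        (λ {v} (u∈ , d∈) →
          cost-cong (All.map f≡ u∈) (All.map f≡ d∈) (All.map g≡ u∈) (All.map g≡ d∈) (lab v))
        ends∈))

open LocalReplacement using (oldEnds∈; oldEnds!; progress)

-- The three rules preserve weightings and lower the cost.

open +-*-Solver using (solve; _:+_; _:=_; con)

-- `Merge` with branches `a`, `b` and stem `c`, freed of the trailing zeros of list sums.
record Fork (f g : ℕ → ℕ) (a b c : ℕ) : Set where
  constructor fork
  field
    left≤  : f c ≤ f a
    right≤ : f c ≤ f b
    stem≥  : 2 * (g a + g b) ≤ g c

Merge⇒Fork : ∀ {f g is a b c} → is ↭ a ∷ b ∷ [] → Merge f g is (c ∷ []) → Fork f g a b c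
Merge⇒Fork {f} {g} {is} {a} {b} {c} p (merge j k) = fork
  (subst (_≤ f a) (+-identityʳ (f c)) (j (∈-resp-↭ (↭-sym p) (here refl))))
  (subst (_≤ f b) (+-identityʳ (f c)) (j (∈-resp-↭ (↭-sym p) (there (here refl)))))
  (subst (λ s → 2 * s ≤ g c)
    (trans (sum-↭ (map⁺ g p)) (cong (g a +_) (+-identityʳ (g b)))) (k (here refl)))

Fork⇒Merge : ∀ {f g a b c} → Fork f g a b c → Merge f g (a ∷ b ∷ []) (c ∷ [])
Fork⇒Merge {f} {g} {a} {b} {c} (fork l r s) = merge
  (λ { (here refl)         → subst (_≤ f a) (sym (+-identityʳ (f c))) l
     ; (there (here refl)) → subst (_≤ f b) (sym (+-identityʳ (f c))) r })
  (λ { (here refl) → subst (λ t → 2 * t ≤ g c) (cong (g a +_) (sym (+-identityʳ (g b)))) s })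

Turn-pair : ∀ {f g a b} → 2 * g b ≤ f a → 2 * g a ≤ f b → Turn f g (a ∷ b ∷ [])
Turn-pair p q (here refl)         (here refl)         a≢b = contradiction refl a≢b
Turn-pair p q (here refl)         (there (here refl)) _   = p
Turn-pair p q (there (here refl)) (here refl)         _   = q
Turn-pair p q (there (here refl)) (there (here refl)) a≢b = contradiction refl a≢b

-- This is where positive weights make the descent strict: for `m = 0` the doubled inequality alone
-- says nothing.
2*m≤n⇒m<n : ∀ {m n} → 0 < n → 2 * m ≤ n → m < n
2*m≤n⇒m<n {zero}  n>0 _    = n>0
2*m≤n⇒m<n {suc m} _   2m≤n = <-≤-trans (m<m+n (suc m) (s≤s z≤n)) 2m≤n

-- The rewriting of rule 1 in terms of weights; rule 2 is the same with f and g exchanged.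
module TurnRedex {f g f′ g′ : ℕ → ℕ} {E is ts : List ℕ} {e₁ e₂ e₃ x d₁ d₂ : ℕ}
  (f≡ : ∀ {e} → e ∈ E → f′ e ≡ f e) (g≡ : ∀ {e} → e ∈ E → g′ e ≡ g e)
  (e₁∈ : e₁ ∈ E) (e₂∈ : e₂ ∈ E) (e₃∈ : e₃ ∈ E) (x≢e₃ : x ≢ e₃)
  (f′d₁ : f′ d₁ ≡ 2 * g e₁) (f′d₂ : f′ d₂ ≡ 2 * g e₂)
  (g′d₁ : g′ d₁ ≡ g e₃) (g′d₂ : g′ d₂ ≡ g e₃)
  (is↭ : is ↭ e₁ ∷ e₂ ∷ []) (M : Merge f g is (x ∷ []))
  (ts↭ : ts ↭ x ∷ e₃ ∷ []) (T : Turn f g ts)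
  where
  private
    open Fork (Merge⇒Fork is↭ M)
    x∈ : x ∈ ts
    x∈ = ∈-resp-↭ (↭-sym ts↭) (here refl)
    e₃∈ts : e₃ ∈ ts
    e₃∈ts = ∈-resp-↭ (↭-sym ts↭) (there (here refl))
    T₁ : 2 * g e₃ ≤ f x
    T₁ = T x∈ e₃∈ts x≢e₃

  -- The old route from `e₃` turns onto `x` and then forks to `e₁`, `e₂`; the new one forks first
  -- and then turns. Both collect one factor 2 at the fork and one at the turn.
  turned : Merge g′ f′ (d₁ ∷ d₂ ∷ []) (e₃ ∷ [])
  turned = Fork⇒Merge (fork
    (≤-reflexive (trans (g≡ e₃∈) (sym g′d₁)))
    (≤-reflexive (trans (g≡ e₃∈) (sym g′d₂)))
    (begin
      2 * (f′ d₁ + f′ d₂)       ≡⟨ cong₂ (λ m n → 2 * (m + n)) f′d₁ f′d₂ ⟩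
      2 * (2 * g e₁ + 2 * g e₂) ≡⟨ cong (2 *_) (*-distribˡ-+ 2 (g e₁) (g e₂)) ⟨
      2 * (2 * (g e₁ + g e₂))   ≤⟨ *-monoʳ-≤ 2 stem≥ ⟩
      2 * g x                   ≤⟨ T e₃∈ts x∈ (x≢e₃ ∘ sym) ⟩
      f e₃                      ≡⟨ f≡ e₃∈ ⟨
      f′ e₃                     ∎))
    where open ≤-Reasoning

  private
    turn : ∀ {e d} → e ∈ E → f x ≤ f e → f′ d ≡ 2 * g e → g′ d ≡ g e₃ → Turn f′ g′ (e ∷ d ∷ [])
    turn e∈ x≤e f′d g′d = Turn-pair {f′} {g′}
      (subst₂ _≤_ (cong (2 *_) (sym g′d)) (sym (f≡ e∈)) (≤-trans T₁ x≤e))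
      (≤-reflexive (trans (cong (2 *_) (g≡ e∈)) (sym f′d)))

  turn-left : Turn f′ g′ (e₁ ∷ d₁ ∷ [])
  turn-left = turn e₁∈ left≤ f′d₁ g′d₁

  turn-right : Turn f′ g′ (e₂ ∷ d₂ ∷ [])
  turn-right = turn e₂∈ right≤ f′d₂ g′d₂

  -- The removed contraction costs `f x`, the new cocontraction `g e₃`, and the old cointeraction
  -- allows a bounce from `x` to `e₃`.
  turn-cost : 0 < f x → sum (map g′ (e₃ ∷ [])) < sum (map f (x ∷ []))
  turn-cost fx>0 = subst₂ _<_
    (trans (sym (g≡ e₃∈)) (sym (+-identityʳ (g′ e₃)))) (sym (+-identityʳ (f x)))
    (2*m≤n⇒m<n fx>0 T₁)

turn-ends : ∀ {e₁ e₂ e₃ d₁ d₂ : ℕ} →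
            e₃ ∷ e₁ ∷ d₁ ∷ e₂ ∷ d₂ ∷ [] ↭ d₁ ∷ d₂ ∷ e₃ ∷ e₁ ∷ e₂ ∷ []
turn-ends {e₁} {e₂} {e₃} {d₁} {d₂} =
  ↭-trans (shift d₁ (e₃ ∷ e₁ ∷ []) (e₂ ∷ d₂ ∷ [])) (prep d₁ (shift d₂ (e₃ ∷ e₁ ∷ e₂ ∷ []) []))

2*n>0 : ∀ {n} → 0 < n → 0 < 2 * n
2*n>0 = *-mono-≤ {1} {2} (s≤s z≤n)

step₁-progress : ∀ {f g A B} → Weighting f g A → Step₁ A B → Progress f g A B
step₁-progress {f} {g} {A} {B} W@(weighting upsOK _ f>0 g>0 _)
  (step e₁ e₂ e₃ x d₁ d₂ (vtx _ us _) (vtx _ ts _) restV restE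
        refl us↭ refl refl ts↭ refl vertsA edgesA d₁∉ d₂∉ d₁≢d₂ vertsB edgesB _ _ _)
  with fresh ← d₁∉ ∷ d₂∉ ∷ [] | new! ← (d₁≢d₂ ∷ []) ∷ [] ∷ []
  with r ← replacement
         {olds = vtx ctr us (x ∷ []) ∷ vtx cint ts [] ∷ []}
         {news = vtx coctr (e₃ ∷ []) (d₁ ∷ d₂ ∷ []) ∷
                 vtx cint (e₁ ∷ d₁ ∷ []) [] ∷ vtx cint (e₂ ∷ d₂ ∷ []) [] ∷ []}
         vertsA edgesA fresh new! vertsB edgesB
     | oldUps ← ↭-trans (++⁺ us↭ (++⁺ʳ [] ts↭)) (++-comm (e₁ ∷ e₂ ∷ []) (x ∷ e₃ ∷ []))
     -- The least weights that the new vertices allow: downwards, `d₁` bounces onto `e₁` and so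
     -- needs `2 * g e₁`; upwards, it joins the stem `e₃` and needs `g e₃`. The same holds for `d₂`.
     | f′ , f′>0 , f≡ , f′d₁ ∷ f′d₂ ∷ [] ← extension ((d₁ , 2 * g e₁) ∷ (d₂ , 2 * g e₂) ∷ [])
         f>0 (2*n>0 (g>0 e₁) ∷ 2*n>0 (g>0 e₂) ∷ []) fresh new!
     | g′ , g′>0 , g≡ , g′d₁ ∷ g′d₂ ∷ [] ← extension ((d₁ , g e₃) ∷ (d₂ , g e₃) ∷ [])
         g>0 (g>0 e₃ ∷ g>0 e₃ ∷ []) fresh new!
  with _ ∷ e₃∈ ∷ e₁∈ ∷ e₂∈ ∷ [] ← oldEnds∈ r ups oldUps upsOK
     | (x≢e₃ ∷ _) ∷ _ ← oldEnds! r ups oldUps upsOK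
  = progress r f≡ g≡ f′>0 g′>0 oldUps ↭-refl turn-ends ↭-refl W λ { (M ∷ T ∷ []) →
      let open TurnRedex f≡ g≡ e₁∈ e₂∈ e₃∈ x≢e₃ f′d₁ f′d₂ g′d₁ g′d₂ us↭ M ts↭ T
      in (turned ∷ turn-left ∷ turn-right ∷ []) , +-monoˡ-< 0 (turn-cost (f>0 x)) }

step₂-progress : ∀ {f g A B} → Weighting f g A → Step₂ A B → Progress f g A B
step₂-progress {f} {g} {A} {B} W@(weighting _ downsOK f>0 g>0 _)
  (step e₁ e₂ e₃ x d₁ d₂ (vtx _ _ ts) (vtx _ _ ds) restV restE
        refl refl ts↭ refl refl ds↭ vertsA edgesA d₁∉ d₂∉ d₁≢d₂ vertsB edgesB _ _ _)
  with fresh ← d₁∉ ∷ d₂∉ ∷ [] | new! ← (d₁≢d₂ ∷ []) ∷ [] ∷ []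
  with r ← replacement
         {olds = vtx int [] ts ∷ vtx coctr (x ∷ []) ds ∷ []}
         {news = vtx ctr (d₁ ∷ d₂ ∷ []) (e₃ ∷ []) ∷
                 vtx int [] (e₁ ∷ d₁ ∷ []) ∷ vtx int [] (e₂ ∷ d₂ ∷ []) ∷ []}
         vertsA edgesA fresh new! vertsB edgesB
     | ts↭′ ← ↭-trans ts↭ (swap e₃ x ↭-refl)
     | f′ , f′>0 , f≡ , f′d₁ ∷ f′d₂ ∷ [] ← extension ((d₁ , f e₃) ∷ (d₂ , f e₃) ∷ [])
         f>0 (f>0 e₃ ∷ f>0 e₃ ∷ []) fresh new!
     | g′ , g′>0 , g≡ , g′d₁ ∷ g′d₂ ∷ [] ← extension ((d₁ , 2 * f e₁) ∷ (d₂ , 2 * f e₂) ∷ [])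
         g>0 (2*n>0 (f>0 e₁) ∷ 2*n>0 (f>0 e₂) ∷ []) fresh new!
  with oldDowns ← ++⁺ ts↭′ (++⁺ʳ [] ds↭)
  with _ ∷ e₃∈ ∷ e₁∈ ∷ e₂∈ ∷ [] ← oldEnds∈ r downs oldDowns downsOK
     | (x≢e₃ ∷ _) ∷ _ ← oldEnds! r downs oldDowns downsOK
  = progress r f≡ g≡ f′>0 g′>0 ↭-refl oldDowns ↭-refl turn-ends W λ { (T ∷ M ∷ []) →
      let open TurnRedex g≡ f≡ e₁∈ e₂∈ e₃∈ x≢e₃ g′d₁ g′d₂ f′d₁ f′d₂ ds↭ M ts↭′ T
      in (turned ∷ turn-left ∷ turn-right ∷ []) , +-monoˡ-< 0 (turn-cost (g>0 x)) }

step₃-progress : ∀ {f g A B} → Weighting f g A → Step₃ A B → Progress f g A B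
step₃-progress {f} {g} {A} {B} W@(weighting upsOK downsOK f>0 g>0 _)
  (step e₁ e₂ e₃ e₄ x f₁₁ f₁₂ f₂₁ f₂₂ (vtx _ us _) (vtx _ _ ds) restV restE
        refl us↭ refl refl refl ds↭ vertsA edgesA fresh new! vertsB edgesB _ _)
  with r ← replacement
         {olds = vtx ctr us (x ∷ []) ∷ vtx coctr (x ∷ []) ds ∷ []}
         {news = vtx coctr (e₁ ∷ []) (f₁₁ ∷ f₁₂ ∷ []) ∷ vtx coctr (e₂ ∷ []) (f₂₁ ∷ f₂₂ ∷ []) ∷
                 vtx ctr (f₁₁ ∷ f₂₁ ∷ []) (e₃ ∷ []) ∷ vtx ctr (f₁₂ ∷ f₂₂ ∷ []) (e₄ ∷ []) ∷ []}
         vertsA edgesA fresh new! vertsB edgesB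
     | oldUps ← ↭-trans (++⁺ʳ (x ∷ []) us↭) (++-comm (e₁ ∷ e₂ ∷ []) (x ∷ []))
     | oldDowns ← prep x (++⁺ʳ [] ds↭)
     -- Each new edge weighs as much as the old edge it leads to: `e₃` or `e₄` downwards, `e₁` or
     -- `e₂` upwards.
     | f′ , f′>0 , f≡ , f′₁₁ ∷ f′₁₂ ∷ f′₂₁ ∷ f′₂₂ ∷ [] ← extension
         ((f₁₁ , f e₃) ∷ (f₁₂ , f e₄) ∷ (f₂₁ , f e₃) ∷ (f₂₂ , f e₄) ∷ [])
         f>0 (f>0 e₃ ∷ f>0 e₄ ∷ f>0 e₃ ∷ f>0 e₄ ∷ []) fresh new!
     | g′ , g′>0 , g≡ , g′₁₁ ∷ g′₁₂ ∷ g′₂₁ ∷ g′₂₂ ∷ [] ← extension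
         ((f₁₁ , g e₁) ∷ (f₁₂ , g e₁) ∷ (f₂₁ , g e₂) ∷ (f₂₂ , g e₂) ∷ [])
         g>0 (g>0 e₁ ∷ g>0 e₁ ∷ g>0 e₂ ∷ g>0 e₂ ∷ []) fresh new!
  with _ ∷ e₁∈ ∷ e₂∈ ∷ [] ← oldEnds∈ r ups oldUps upsOK
     | _ ∷ e₃∈ ∷ e₄∈ ∷ [] ← oldEnds∈ r downs oldDowns downsOK
  = progress r f≡ g≡ f′>0 g′>0 oldUps oldDowns
      (↭-trans (++-comm (e₁ ∷ e₂ ∷ []) (f₁₁ ∷ f₂₁ ∷ f₁₂ ∷ f₂₂ ∷ []))
               (prep f₁₁ (swap f₂₁ f₁₂ ↭-refl)))
      ↭-refl W λ { (M ∷ N ∷ []) →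
        let fork e₁≥ e₂≥ x↑≥ = Merge⇒Fork us↭ M
            fork e₃≥ e₄≥ x↓≥ = Merge⇒Fork ds↭ N
        -- Each bound passes through `x`: the stem inequality of one old vertex is followed by the
        -- branch inequality of the other.
        in ( Fork⇒Merge (new-fork g f g≡ e₁∈ g′₁₁ g′₁₂ f≡ f′₁₁ f′₁₂ (≤-trans x↓≥ e₁≥))
           ∷ Fork⇒Merge (new-fork g f g≡ e₂∈ g′₂₁ g′₂₂ f≡ f′₂₁ f′₂₂ (≤-trans x↓≥ e₂≥))
           ∷ Fork⇒Merge (new-fork f g f≡ e₃∈ f′₁₁ f′₂₁ g≡ g′₁₁ g′₂₁ (≤-trans x↑≥ e₃≥))
           ∷ Fork⇒Merge (new-fork f g f≡ e₄∈ f′₁₂ f′₂₂ g≡ g′₁₂ g′₂₂ (≤-trans x↑≥ e₄≥))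
           ∷ []) ,
           cost< (g≡ e₁∈) (g≡ e₂∈) (f≡ e₃∈) (f≡ e₄∈)
             (2*m≤n⇒m<n (f>0 x) x↓≥) (2*m≤n⇒m<n (g>0 x) x↑≥) }
  where
  new-fork : ∀ f g {E f′ g′ a b c m n} →
             (∀ {e} → e ∈ E → f′ e ≡ f e) → c ∈ E → f′ a ≡ f c → f′ b ≡ f c →
             (∀ {e} → e ∈ E → g′ e ≡ g e) → g′ a ≡ m → g′ b ≡ n →
             2 * (m + n) ≤ g c → Fork f′ g′ a b c
  new-fork f g f≡ c∈ f′a f′b g≡ g′a g′b le = fork
    (≤-reflexive (trans (f≡ c∈) (sym f′a))) (≤-reflexive (trans (f≡ c∈) (sym f′b)))
    (subst₂ _≤_ (cong₂ (λ m n → 2 * (m + n)) (sym g′a) (sym g′b)) (sym (g≡ c∈)) le)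

  -- The two new contractions together cost less than the old one, and likewise the cocontractions;
  -- each bound is the stem inequality of the other old vertex. The zeros are those of the unfolded
  -- sums.
  cost< : ∀ {p q r s p′ q′ r′ s′ m n} → p′ ≡ p → q′ ≡ q → r′ ≡ r → s′ ≡ s →
          r + s < m → p + q < n →
          (p′ + 0) + ((q′ + 0) + ((r′ + 0) + ((s′ + 0) + 0))) < (m + 0) + ((n + 0) + 0)
  cost< {p} {q} {r} {s} {m = m} {n} refl refl refl refl r+s<m p+q<n =
    subst₂ _<_ (solve 4 (λ p q r s → (r :+ s) :+ (p :+ q) :=
                 (p :+ con 0) :+ ((q :+ con 0) :+ ((r :+ con 0) :+ ((s :+ con 0) :+ con 0))))
                 refl p q r s)
               (solve 2 (λ m n → m :+ n := (m :+ con 0) :+ ((n :+ con 0) :+ con 0)) refl m n)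
               (+-mono-< r+s<m p+q<n)

→c-progress : ∀ {f g A B} → Weighting f g A → A →c B → Progress f g A B
→c-progress W (inj₁ s)        = step₁-progress W s
→c-progress W (inj₂ (inj₁ s)) = step₂-progress W s
→c-progress W (inj₂ (inj₂ s)) = step₃-progress W s

-- Walks along oriented edges, and their absence of repetitions.

data Dir : Set where
  ↓ ↑ : Dir

opposite : Dir → Dir
opposite ↓ = ↑
opposite ↑ = ↓

Arc : Set
Arc = Dir × ℕ

edge : Arc → ℕ
edge = proj₂

exits : Dir → Vertex → List ℕ
exits ↓ = downs
exits ↑ = ups

entries : Dir → Vertex → List ℕ
entries = exits ∘ opposite

∈-concatMap-lookup : ∀ {A B : Set} (f : A → List B) {e} xs i → e ∈ f (lookup xs i) → e ∈ concatMap f xs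
∈-concatMap-lookup f xs i e∈ = ∈-concatMap⁺ f {xs = xs} (lose (∈-lookup i) e∈)

Unique-concatMap-lookup : ∀ {A : Set} (f : A → List ℕ) {e} xs → Unique (concatMap f xs) →
  ∀ i j → e ∈ f (lookup xs i) → e ∈ f (lookup xs j) → i ≡ j
Unique-concatMap-lookup f (x ∷ xs) u zero    zero    p q = refl
Unique-concatMap-lookup f (x ∷ xs) u zero    (suc j) p q =
  ⊥-elim (Unique-++-disjoint (f x) u p (∈-concatMap-lookup f xs j q))
Unique-concatMap-lookup f (x ∷ xs) u (suc i) zero    p q =
  ⊥-elim (Unique-++-disjoint (f x) u q (∈-concatMap-lookup f xs i p))
Unique-concatMap-lookup f (x ∷ xs) u (suc i) (suc j) p q =
  cong suc (Unique-concatMap-lookup f xs (Unique-++⁻ʳ (f x) u) i j p q)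

module Walks (A : Flow) where

  Leaves Enters : Vtx A → Arc → Set
  Leaves u (d , e) = e ∈ exits d (vat A u)
  Enters u (d , e) = e ∈ entries d (vat A u)

  data Through (m : Vtx A) : Arc → Arc → Set where
    pass   : ∀ {d e f} → Enters m (d , e) → Leaves m (d , f) → Through m (d , e) (d , f)
    bounce : ∀ {d e f} → Enters m (d , e) → Leaves m (opposite d , f) → IsAI (vat A m) → e ≢ f →
             Through m (d , e) (opposite d , f)

  enters : ∀ {m α β} → Through m α β → Enters m α
  enters (pass p _)       = p
  enters (bounce p _ _ _) = p

  leaves : ∀ {m α β} → Through m α β → Leaves m β
  leaves (pass _ q)       = q
  leaves (bounce _ q _ _) = q

  -- The first arc is an index, separate from the later ones: a walk is never empty, and the
  -- direction in which it starts stays visible.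
  data Walk (u v : Vtx A) : Arc → List Arc → Set where
    end : ∀ {α} → Leaves u α → Enters v α → Walk u v α []
    go  : ∀ {m α β βs} → Leaves u α → Through m α β → Walk m v β βs → Walk u v α (β ∷ βs)

  Monotone : Dir → Vtx A → Vtx A → List ℕ → Set
  Monotone ↓ u v es = DPath A u v es
  Monotone ↑ u v es = DPath A v u (reverse es)

  DPath-∷ʳ : ∀ {u m v e es} → DPath A u m es → e ∈ downs (vat A m) → e ∈ ups (vat A v) →
             DPath A u v (es ++ (e ∷ []))
  DPath-∷ʳ (one p q)    p′ q′ = cons p q (one p′ q′)
  DPath-∷ʳ (cons p q π) p′ q′ = cons p q (DPath-∷ʳ π p′ q′)

  Monotone-one : ∀ d {u v e} → Leaves u (d , e) → Enters v (d , e) → Monotone d u v (e ∷ [])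
  Monotone-one ↓ p q = one p q
  Monotone-one ↑ p q = one q p

  Monotone-∷ : ∀ d {u m v e es} → Leaves u (d , e) → Enters m (d , e) →
               Monotone d m v es → Monotone d u v (e ∷ es)
  Monotone-∷ ↓ p q π = cons p q π
  Monotone-∷ ↑ {u} {v = v} {e} {es} p q π =
    subst (DPath A v u) (sym (unfold-reverse e es)) (DPath-∷ʳ π q p)

  Monotone⇒Path : ∀ d {u v es} → Monotone d u v es → Path A u v es
  Monotone⇒Path ↓ = inj₁
  Monotone⇒Path ↑ = inj₂

  -- AIPath does not remember its first monotone piece, which must be visible for
  -- another edge of the same direction to be put in front.
  data Pieces (d : Dir) (u v : Vtx A) : List ℕ → Set where
    lone : ∀ {e es} → Monotone d u v (e ∷ es) → Pieces d u v (e ∷ es)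
    more : ∀ {m e es fs} → Monotone d u m (e ∷ es) → IsAI (vat A m) → last (e ∷ es) ≢ head fs →
           AIPath A m v fs → Pieces d u v (e ∷ es ++ fs)

  Pieces⇒AIPath : ∀ {d u v es} → Pieces d u v es → AIPath A u v es
  Pieces⇒AIPath {d} (lone π)           = path (Monotone⇒Path d π)
  Pieces⇒AIPath {d} (more π ai turn ρ) = join (path (Monotone⇒Path d π)) ρ ai turn

  Pieces-∷ : ∀ {d u m v e es} → Leaves u (d , e) → Enters m (d , e) →
             Pieces d m v es → Pieces d u v (e ∷ es)
  Pieces-∷ {d} p q (lone π)           = lone (Monotone-∷ d p q π)
  Pieces-∷ {d} p q (more π ai turn ρ) = more (Monotone-∷ d p q π) ai turn ρ

  -- A pass lengthens the first monotone piece, and a bounce closes a piece of one edge in front of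
  -- the rest; the `e ≢ f` of the bounce is the side condition of `join`.
  Walk⇒Pieces : ∀ {u v α βs} → Walk u v α βs → Pieces (proj₁ α) u v (map edge (α ∷ βs))
  Walk⇒Pieces {α = d , _} (end p q) = lone (Monotone-one d p q)
  Walk⇒Pieces (go p (pass q _) w) = Pieces-∷ p q (Walk⇒Pieces w)
  Walk⇒Pieces {α = d , _} (go p (bounce q _ ai e≢f) w) =
    more (Monotone-one d p q) ai (e≢f ∘ just-injective) (Pieces⇒AIPath (Walk⇒Pieces w))

  -- The cut walk ends at the source of `γ`, which `source-unique` can identify with an earlier
  -- vertex to close the walk.
  prefix : ∀ {u v α γ} βs {γs} → Walk u v α (βs ++ γ ∷ γs) → ∃ λ m → Walk u m α βs × Leaves m γ
  prefix []       (go p t w) = _ , end p (enters t) , leaves t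
  prefix (β ∷ βs) (go p t w) with m , w′ , q ← prefix βs w = m , go p t w′ , q

  module _ (ups! : Unique (concatMap ups (verts A))) (downs! : Unique (concatMap downs (verts A)))
           (cycleFree : CycleFree A) where

    source-unique : ∀ {u v} α → Leaves u α → Leaves v α → u ≡ v
    source-unique (↓ , _) = Unique-concatMap-lookup downs (verts A) downs! _ _
    source-unique (↑ , _) = Unique-concatMap-lookup ups (verts A) ups! _ _

    not-closed : ∀ {u α βs} → Walk u u α βs → ¬ Unique (map edge (α ∷ βs))
    not-closed w u! = cycleFree _ _ (Pieces⇒AIPath (Walk⇒Pieces w) , u!)

    same-or-opposite : ∀ d d′ → d ≡ d′ ⊎ opposite d ≡ d′
    same-or-opposite ↓ ↓ = inj₁ refl
    same-or-opposite ↓ ↑ = inj₂ refl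
    same-or-opposite ↑ ↓ = inj₂ refl
    same-or-opposite ↑ ↑ = inj₁ refl

    no-U-turn : ∀ {m} d {e} → ¬ Through m (d , e) (opposite d , e)
    no-U-turn ↓ (bounce _ _ _ e≢e) = e≢e refl
    no-U-turn ↑ (bounce _ _ _ e≢e) = e≢e refl

    -- The part of a walk up to a repeated edge closes up: just before the second
    -- occurrence if both have the same direction, and strictly between the two
    -- occurrences if the directions are opposite.
    no-return : ∀ {u v α βs} → Walk u v α βs → Unique (map edge βs) → edge α ∉ map edge βs
    no-return {α = d , e} w βs! e∈ with ∈-map⁻ edge e∈
    ... | (d′ , _) , γ∈ , refl with ∈-∃++ γ∈
    ... | bs , γs , refl with same-or-opposite d d′
    ... | inj₁ refl with prefix bs w
    ...   | m , w′ , p = closes (source-unique (d , e) p (start w)) w′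
      where
      start : ∀ {u v α βs} → Walk u v α βs → Leaves u α
      start (end p _)  = p
      start (go p _ _) = p
      closes : ∀ {u m} → m ≡ u → ¬ Walk u m (d , e) bs
      -- `βs` omits the first occurrence of the edge but contains the second, which is moved to the
      -- front to stand for it.
      closes refl w′ = not-closed w′ (Unique-++⁻ˡ (map edge ((d , e) ∷ bs))
        (subst Unique (cong (e ∷_) (map-++ edge bs γs))
          (Unique-resp-↭ (map⁺ edge (shift (d , e) bs γs)) βs!)))
    -- Nothing lies between the two occurrences, so there is no closed walk to exhibit; going
    -- straight back along an edge is excluded by `bounce` itself.
    no-return {α = d , _} w βs! e∈ | (d′ , _) , γ∈ , refl | [] , γs , refl | inj₂ refl with w
    ...   | go _ t _ = no-U-turn d t
    no-return {α = d , e} w βs! e∈ | (d′ , _) , γ∈ , refl | β ∷ bs , γs , refl | inj₂ refl with w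
    ...   | go _ t w₁ with prefix bs w₁
    ...     | m , w′ , p = closes (source-unique (opposite d , e) p (enters t)) w′
      where
      closes : ∀ {u m} → m ≡ u → ¬ Walk u m β bs
      closes refl w′ = not-closed w′ (Unique-++⁻ˡ (map edge (β ∷ bs))
        (subst Unique (map-++ edge (β ∷ bs) _) βs!))

    Walk-unique : ∀ {u v α βs} → Walk u v α βs → Unique (map edge (α ∷ βs))
    Walk-unique (end _ _)      = [] ∷ []
    Walk-unique w@(go _ _ w′) with u! ← Walk-unique w′ = ¬Any⇒All¬ _ (no-return w u!) ∷ u!

    _⇝_ : Arc → Arc → Set
    α ⇝ β = ∃ λ m → Through m α β

    walk : ∀ {u α β} → Leaves u α → TransClosure _⇝_ α β → ∃₂ λ v βs → Walk u v α βs × Leaves v β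
    walk p [ m , t ]      = m , [] , end p (enters t) , leaves t
    walk p ((m , t) ∷ ts) with v , βs , w , q ← walk (leaves t) ts = v , _ , go p t w , q

    -- A chain from `α` to itself yields a walk that returns to the source of `α`. By `Walk-unique`
    -- it repeats no edge, so it is an ai-cycle.
    ⇝-irrefl : ∀ {α} → ¬ TransClosure _⇝_ α α
    -- `α` is also the last arc of the chain, so it leaves a vertex and does not start at a dangling
    -- end.
    ⇝-irrefl {α} ts with target ts
      where
      target : ∀ {α β} → TransClosure _⇝_ α β → ∃ λ v → Leaves v β
      target [ m , t ] = m , leaves t
      target (_ ∷ ts)  = target ts
    ... | u , p with walk p ts
    ...   | v , βs , w , q = closes (source-unique α q p) w
      where
      closes : ∀ {u v βs} → v ≡ u → ¬ Walk u v α βs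
      closes refl w = not-closed w (Walk-unique w)

-- Enumerating continuations, and weights by well-founded recursion.

arcs : Flow → List Arc
arcs A = cartesianProduct (↓ ∷ ↑ ∷ []) (edges A)

isAI? : ∀ v → Dec (IsAI v)
isAI? (vtx int   _ _) = yes (inj₁ refl)
isAI? (vtx cint  _ _) = yes (inj₂ refl)
isAI? (vtx wk    _ _) = no λ { (inj₁ ()) ; (inj₂ ()) }
isAI? (vtx cowk  _ _) = no λ { (inj₁ ()) ; (inj₂ ()) }
isAI? (vtx ctr   _ _) = no λ { (inj₁ ()) ; (inj₂ ()) }
isAI? (vtx coctr _ _) = no λ { (inj₁ ()) ; (inj₂ ()) }

open DecMembership _≟_ using (_∈?_)

-- The counterpart of `Through` as a list, to be summed over. Only bounces are listed at a
-- (co)interaction and only passes elsewhere.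
onward : Vertex → Arc → List Arc
onward v (d , e) with e ∈? entries d v | isAI? v
... | no _  | _     = []
... | yes _ | yes _ = map (opposite d ,_) (filter (λ f → ¬? (e ≟ f)) (entries d v))
... | yes _ | no _  = map (d ,_) (exits d v)

onward-ai : ∀ v {d e f} → IsAI v → e ∈ entries d v → f ∈ entries d v → e ≢ f →
            (opposite d , f) ∈ onward v (d , e)
onward-ai v {d} {e} ai e∈ f∈ e≢f with e ∈? entries d v | isAI? v
... | no e∉ | _      = contradiction e∈ e∉
... | yes _ | yes _  = ∈-map⁺ _ (∈-filter⁺ (λ f → ¬? (e ≟ f)) f∈ e≢f)
... | yes _ | no ¬ai = contradiction ai ¬ai

onward-¬ai : ∀ v {d e} → ¬ IsAI v → e ∈ entries d v → onward v (d , e) ≡ map (d ,_) (exits d v)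
onward-¬ai v {d} {e} ¬ai e∈ with e ∈? entries d v | isAI? v
... | no e∉ | _      = contradiction e∈ e∉
... | yes _ | yes ai = contradiction ai ¬ai
... | yes _ | no _   = refl

∈⇒≤sum : ∀ {n ns} → n ∈ ns → n ≤ sum ns
∈⇒≤sum {ns = n ∷ ns} (here refl) = m≤m+n n (sum ns)
∈⇒≤sum {ns = m ∷ ns} (there n∈)  = m≤n⇒m≤o+n m (∈⇒≤sum n∈)

sum-concatMap-≤ : ∀ {A B : Set} (h : B → ℕ) (f : A → List B) {x xs} → x ∈ xs →
                  sum (map h (f x)) ≤ sum (map h (concatMap f xs))
sum-concatMap-≤ h f {x} {y ∷ xs} x∈ = subst (sum (map h (f x)) ≤_)
  (sym (trans (cong sum (map-++ h (f y) (concatMap f xs))) (sum-++ (map h (f y)) _))) (split x∈)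
  where
  split : x ∈ y ∷ xs → sum (map h (f x)) ≤ sum (map h (f y)) + sum (map h (concatMap f xs))
  split (here refl) = m≤m+n _ _
  split (there x∈)  = m≤n⇒m≤o+n _ (sum-concatMap-≤ h f x∈)

-- The equation serves as the recursive definition. `mapWith∈` hands each recursive call its
-- membership proof, and `suc` makes every weight positive.
WellFounded⇒weight : ∀ {A : Set} (successors : A → List A) → WellFounded (λ y x → y ∈ successors x) →
                     ∃ λ weight → ∀ x → weight x ≡ suc (2 * sum (map weight (successors x)))
WellFounded⇒weight {A} successors wf = wfRec (λ _ → ℕ) suc-2*sum , λ x → trans unfold-wfRec
  (cong (λ ns → suc (2 * sum ns)) (mapWith∈≗map (wfRec (λ _ → ℕ) suc-2*sum) (successors x)))
  where
  suc-2*sum : ∀ x → (∀ {y} → y ∈ successors x → ℕ) → ℕ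
  suc-2*sum x rec = suc (2 * sum (mapWith∈ (successors x) rec))
  open WF.All wf _ using (wfRec)
  open WF.FixPoint wf (λ _ → ℕ) suc-2*sum
    (λ x eq → cong (λ ns → suc (2 * sum ns)) (mapWith∈-cong (successors x) _ _ eq)) using (unfold-wfRec)

-- The initial weighting of a cycle-free flow.

module InitialWeighting (A : Flow) (wf : WF A) (cycleFree : CycleFree A) where
  open Walks A

  private
    verticesOK = proj₁ (proj₂ wf)
    ups! = proj₁ (proj₂ (proj₂ wf))
    downs! = proj₁ (proj₂ (proj₂ (proj₂ wf)))

  _→ₐ_ : Arc → Arc → Set
  _→ₐ_ = _⇝_ ups! downs! cycleFree

  successors : Arc → List Arc
  successors α = concatMap (λ v → onward v α) (verts A)

  onward⇒Through : ∀ m {α β} → β ∈ onward (vat A m) α → Through m α β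
  onward⇒Through m {d , e} β∈ with e ∈? entries d (vat A m) | isAI? (vat A m)
  ... | yes e∈ | yes ai with f , f∈ , refl ← ∈-map⁻ _ β∈
                        with f∈ , e≢f ← ∈-filter⁻ (λ f → ¬? (e ≟ f)) {xs = entries d (vat A m)} f∈
                        = bounce e∈ f∈ ai e≢f
  ... | yes e∈ | no _   with f , f∈ , refl ← ∈-map⁻ _ β∈ = pass e∈ f∈

  successors⇒→ₐ : ∀ α {β} → β ∈ successors α → α →ₐ β
  successors⇒→ₐ α {β} β∈ = Any.index β∈any , onward⇒Through _ (lookup-index β∈any)
    where
    β∈any : Any (λ v → β ∈ onward v α) (verts A)
    β∈any = ∈-concatMap⁻ (λ v → onward v α) {xs = verts A} β∈

  incident∈ : ∀ m {e} → e ∈ incident (vat A m) → e ∈ edges A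
  incident∈ m = All.lookup (proj₁ (proj₂ (proj₂ (All.lookup verticesOK (∈-lookup m)))))

  Leaves⇒∈arcs : ∀ {m} α → Leaves m α → α ∈ arcs A
  Leaves⇒∈arcs {m} (↓ , e) p =
    ∈-cartesianProduct⁺ {xs = ↓ ∷ ↑ ∷ []} (here refl) (incident∈ m (∈-++⁺ʳ (ups (vat A m)) p))
  Leaves⇒∈arcs {m} (↑ , e) p =
    ∈-cartesianProduct⁺ {xs = ↓ ∷ ↑ ∷ []} (there (here refl)) (incident∈ m (∈-++⁺ˡ p))

  -- Positions in the list of arcs form a finite set, on which a strict order is Noetherian;
  -- irreflexivity is `⇝-irrefl`.
  _⊏_ : (i j : Fin (length (arcs A))) → Set
  _⊏_ = TransClosure (λ i j → lookup (arcs A) i →ₐ lookup (arcs A) j)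

  ⊏-noetherian : WellFounded (flip _⊏_)
  ⊏-noetherian = spo-noetherian record
    { isEquivalence = isEquivalence
    ; irrefl        = λ { refl → ⇝-irrefl ups! downs! cycleFree ∘ TransClosure-lookup }
    ; trans         = Plus._++_
    ; <-resp-≈      = (λ { refl → λ p → p }) , (λ { refl → λ p → p })
    }
    where
    TransClosure-lookup : ∀ {i j} → i ⊏ j → TransClosure _→ₐ_ (lookup (arcs A) i) (lookup (arcs A) j)
    TransClosure-lookup [ p ]    = [ p ]
    TransClosure-lookup (p ∷ ps) = p ∷ TransClosure-lookup ps

  _≺_ : Arc → Arc → Set
  β ≺ α = β ∈ successors α

  ≺-wellFounded : WellFounded _≺_
  -- `α` may carry a number that names no edge, but every successor leaves a vertex and so lies in
  -- `arcs A`.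
  ≺-wellFounded α = acc λ β∈ → acc∈arcs (≺⇒∈arcs α β∈)
    where
    ≺⇒∈arcs : ∀ α {β} → β ≺ α → β ∈ arcs A
    ≺⇒∈arcs α β∈ = Leaves⇒∈arcs _ (leaves (proj₂ (successors⇒→ₐ α β∈)))
    acc-lookup : ∀ i → Acc (flip _⊏_) i → Acc _≺_ (lookup (arcs A) i)
    acc-lookup i (acc rs) = acc λ β∈ →
      let α = lookup (arcs A) i
          β∈arcs = ≺⇒∈arcs α β∈
          β≡ = lookup-index β∈arcs
      in subst (Acc _≺_) (sym β≡)
           (acc-lookup (Any.index β∈arcs) (rs [ subst (α →ₐ_) β≡ (successors⇒→ₐ α β∈) ]))
    acc∈arcs : ∀ {α} → α ∈ arcs A → Acc _≺_ α
    acc∈arcs α∈ = subst (Acc _≺_) (sym (lookup-index α∈))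
      (acc-lookup (Any.index α∈) (⊏-noetherian (Any.index α∈)))

  module _ (weight : Arc → ℕ)
           (weight-unfold : ∀ α → weight α ≡ suc (2 * sum (map weight (successors α)))) where

    w : Dir → ℕ → ℕ
    w d e = weight (d , e)

    onward≤ : ∀ {v} α → v ∈ verts A → 2 * sum (map weight (onward v α)) ≤ weight α
    onward≤ {v} α v∈ = subst (2 * sum (map weight (onward v α)) ≤_) (sym (weight-unfold α))
      (m≤n⇒m≤1+n (*-monoʳ-≤ 2 (sum-concatMap-≤ weight (λ v → onward v α) v∈)))

    pass≤ : ∀ {v d e} → v ∈ verts A → ¬ IsAI v → e ∈ entries d v →
            2 * sum (map (w d) (exits d v)) ≤ w d e
    pass≤ {v} {d} {e} v∈ ¬ai e∈ = subst (λ n → 2 * sum n ≤ w d e)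
      (trans (cong (map weight) (onward-¬ai v ¬ai e∈)) (sym (map-∘ (exits d v)))) (onward≤ (d , e) v∈)

    bounce≤ : ∀ {v d e f} → v ∈ verts A → IsAI v → e ∈ entries d v → f ∈ entries d v → e ≢ f →
              2 * w (opposite d) f ≤ w d e
    bounce≤ {v} {d} {e} v∈ ai e∈ f∈ e≢f = ≤-trans
      (*-monoʳ-≤ 2 (∈⇒≤sum (∈-map⁺ weight (onward-ai v ai e∈ f∈ e≢f)))) (onward≤ (d , e) v∈)

    balanced : ∀ {v} → v ∈ verts A → BalancedAt (w ↓) (w ↑) v
    balanced {vtx int   _ _} v∈ = bounce≤ v∈ (inj₁ refl)
    balanced {vtx cint  _ _} v∈ = bounce≤ v∈ (inj₂ refl)
    balanced {vtx wk    _ _} v∈ = tt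
    balanced {vtx cowk  _ _} v∈ = tt
    balanced {vtx ctr   _ _} v∈ = merge
      -- The factor 2 is dropped from branch to stem: the rules give a new branch, oriented towards
      -- its stem, exactly the weight of that stem.
      (λ e∈ → ≤-trans (m≤m+n _ _) (pass≤ v∈ (λ { (inj₁ ()) ; (inj₂ ()) }) e∈))
      (pass≤ v∈ (λ { (inj₁ ()) ; (inj₂ ()) }))
    balanced {vtx coctr _ _} v∈ = merge
      (λ e∈ → ≤-trans (m≤m+n _ _) (pass≤ v∈ (λ { (inj₁ ()) ; (inj₂ ()) }) e∈))
      (pass≤ v∈ (λ { (inj₁ ()) ; (inj₂ ()) }))

    balanced⇒weighting : Weighting (w ↓) (w ↑) A
    balanced⇒weighting = weighting
      (ups! , side∈ ups (λ _ → ∈-++⁺ˡ)) (downs! , side∈ downs (λ v → ∈-++⁺ʳ (ups v)))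
      (λ e → positive (↓ , e)) (λ e → positive (↑ , e)) (All.tabulate balanced)
      where
      positive : ∀ α → 0 < weight α
      positive α = subst (0 <_) (sym (weight-unfold α)) (s≤s z≤n)
      side∈ : ∀ side → (∀ v {e} → e ∈ side v → e ∈ incident v) →
              All (_∈ edges A) (concatMap side (verts A))
      side∈ side side⊆ = All.tabulate λ e∈ →
        let v∈any = ∈-concatMap⁻ side {xs = verts A} e∈
        in incident∈ (Any.index v∈any) (side⊆ (vat A (Any.index v∈any)) (lookup-index v∈any))

  initial : ∃₂ λ f g → Weighting f g A
  initial = from-weight (WellFounded⇒weight successors ≺-wellFounded)
    where
    from-weight : (∃ λ weight → ∀ α → weight α ≡ suc (2 * sum (map weight (successors α)))) →
                  ∃₂ λ f g → Weighting f g A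
    from-weight (weight , unfold) =
      w weight unfold ↓ , w weight unfold ↑ , balanced⇒weighting weight unfold

-- Infinite descent along a chain.

-- Induction on the total cost. The weights are general because each step supplies new ones.
no-chain : ∀ {n f g} → Acc _<_ n → (A : ℕ → Flow) → Weighting f g (A 0) →
           totalCost f g (verts (A 0)) ≡ n → ¬ (∀ i → A i →c A (suc i))
no-chain (acc rs) A W refl steps with →c-progress W (steps 0)
... | _ , _ , W′ , dec = no-chain (rs dec) (A ∘ suc) W′ refl (steps ∘ suc)

theorem4p22 : (A : ℕ → Flow) → WF (A 0) → CycleFree (A 0) →
    ¬ (∀ n → A n →c A (suc n))
theorem4p22 A wf cycleFree =
  no-chain (<-wellFounded _) A (proj₂ (proj₂ (InitialWeighting.initial (A 0) wf cycleFree))) refl
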